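{- Let $\Sigma$ be a finite alphabet, let $q$ be a finite picture of size $w\times h$ over $\Sigma$, and let $\mathbf{w}:\mathbb{Z}^2\to\Sigma$ be an infinite $q$-coverable picture. If $q$ has a corner without any non-empty border, then $\mathbf{w}$ has zero topological entropy.
   Context: A finite picture (block) of size $w\times h$ is a word indexed by a rectangle of width $w$ and height $h$; here $q$ is non-empty. A block $u\neq q$ is a border of $q$ when $u$ occurs in two opposite corners of $q$ (i.e. both in the bottom-left and the top-right corners of $q$, or both in the top-left and the bottom-right corners of $q$). A corner of $q$ is without any non-empty border if no non-empty block $u\ne q$ occurs both in that corner of $q$ and in the opposite corner of $q$; borders of full width or full height are taken into account. The infinite picture $\mathbf{w}$ is $q$-coverable if every position of $\mathbb{Z}^2$ belongs to some occurrence of $q$ in $\mathbf{w}$. Let $c_{\mathbf{w}}(n,m)$ be the number of different $n\times m$-blocks occurring in $\mathbf{w}$; the topological entropy of $\mathbf{w}$ is $H(\mathbf{w})=\lim_{n\to\infty}\frac{\log_{|\Sigma|}c_{\mathbf{w}}(n,n)}{n^2}$ (with $|\Sigma|\ge 2$). -}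

module Defs where

open import Data.Nat.Base as ℕ using (ℕ; _∸_; _^_)
open import Data.Integer.Base as ℤ using (ℤ; +_; 0ℤ; ∣_∣)
open import Data.Rational.Unnormalised.Base as ℚ using (ℚᵘ; 0ℚᵘ; ↥_; ↧ₙ_)
open import Data.Fin.Base using (Fin; toℕ)
open import Data.Vec.Base using (Vec; lookup)
open import Data.Product.Base using (Σ-syntax; ∃; ∃-syntax; _×_; _,_)
open import Function.Definitions using (Injective)
open import Relation.Nullary.Negation.Core using (¬_)
open import Relation.Binary.PropositionalEquality.Core using (_≡_; _≢_)

-- Rows are listed from bottom to top, so cell (0 , 0) is the bottom-left one.
Block : Set → ℕ → ℕ → Set
Block A w h = Vec (Vec A w) h

cell : ∀ {A w h} → Block A w h → Fin w → Fin h → A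
cell u i j = lookup (lookup u j) i

Picture : Set → Set
Picture A = Σ[ w ∈ ℕ ] Σ[ h ∈ ℕ ] Block A w h

InfinitePicture : Set → Set
InfinitePicture A = ℤ → ℤ → A

data Corner : Set where
  bottomLeft bottomRight topLeft topRight : Corner

opposite : Corner → Corner
opposite bottomLeft  = topRight
opposite bottomRight = topLeft
opposite topLeft     = bottomRight
opposite topRight    = bottomLeft

record OccursAt {A w′ h′ w h} (u : Block A w′ h′) (q : Block A w h) (a b : ℕ) : Set where
  field
    fits-width  : a ℕ.+ w′ ℕ.≤ w
    fits-height : b ℕ.+ h′ ℕ.≤ h
    agrees      : ∀ i j i′ j′ → toℕ i ≡ a ℕ.+ toℕ i′ → toℕ j ≡ b ℕ.+ toℕ j′ →
                  cell q i j ≡ cell u i′ j′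

OccursInCorner : ∀ {A w′ h′ w h} → Corner → Block A w′ h′ → Block A w h → Set
OccursInCorner                           bottomLeft  u q = OccursAt u q 0 0
OccursInCorner {w′ = w′} {w = w}         bottomRight u q = OccursAt u q (w ∸ w′) 0
OccursInCorner {h′ = h′} {h = h}         topLeft     u q = OccursAt u q 0 (h ∸ h′)
OccursInCorner {w′ = w′} {h′} {w} {h}    topRight    u q = OccursAt u q (w ∸ w′) (h ∸ h′)

record IsBorder {A w′ h′ w h} (k : Corner) (u : Block A w′ h′) (q : Block A w h) : Set where
  field
    proper      : _≢_ {A = Picture A} (w′ , h′ , u) (w , h , q)
    at-corner   : OccursInCorner k u q
    at-opposite : OccursInCorner (opposite k) u q

WithoutNonEmptyBorder : ∀ {A w h} → Block A w h → Corner → Set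
WithoutNonEmptyBorder {A} q k =
  ∀ w′ h′ → 1 ℕ.≤ w′ → 1 ℕ.≤ h′ → (u : Block A w′ h′) → ¬ IsBorder k u q

OccursAtℤ² : ∀ {A w h} → Block A w h → InfinitePicture A → ℤ → ℤ → Set
OccursAtℤ² u p x y = ∀ i j → p (x ℤ.+ + toℕ i) (y ℤ.+ + toℕ j) ≡ cell u i j

Occurs : ∀ {A w h} → InfinitePicture A → Block A w h → Set
Occurs p u = ∃[ x ] ∃[ y ] OccursAtℤ² u p x y

Coverable : ∀ {A w h} → Block A w h → InfinitePicture A → Set
Coverable {w = w} {h} q p =
  ∀ x y → ∃[ a ] ∃[ b ] OccursAtℤ² q p a b ×
    (Σ[ i ∈ Fin w ] x ≡ a ℤ.+ + toℕ i) × (Σ[ j ∈ Fin h ] y ≡ b ℤ.+ + toℕ j)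

-- Occurrence in an infinite picture is not decidable, so the number of blocks
-- satisfying it is not available as an element of ℕ.  A count is given instead
-- by its lower and upper bounds among the natural numbers; if the count is the
-- natural number c, these are the k with k ≤ c and the k with c ≤ k.
record Count : Set₁ where
  field
    AtLeast : ℕ → Set
    AtMost  : ℕ → Set

open Count public

count : {B : Set} → (B → Set) → Count
count {B} P .AtLeast k =
  Σ[ f ∈ (Fin k → B) ] Injective _≡_ _≡_ f × (∀ i → P (f i))
count P .AtMost k = ∀ l → count P .AtLeast l → l ℕ.≤ k

complexity : ∀ {A} → InfinitePicture A → ℕ → ℕ → Count
complexity {A} p n m = count {Block A n m} (Occurs p)

-- A real number x, presented as a Dedekind cut: Below r means r < x and
-- Above r means x < r.
record Cut : Set₁ where
  field
    Below : ℚᵘ → Set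
    Above : ℚᵘ → Set

open Cut public

_⁺ _⁻ : ℤ → ℕ
a ⁺ = ∣ a ℤ.⊔ 0ℤ ∣
a ⁻ = ∣ (ℤ.- a) ℤ.⊔ 0ℤ ∣

-- For b ≥ 2 and d ≥ 1, a / d < log_b c  iff  b ^ a < c ^ d; the negative part of
-- the exponent a is moved to the other side.
log : ℕ → Count → Cut
log b C .Below r = ∃[ c ] AtLeast C c × b ^ ((↥ r) ⁺) ℕ.< c ^ (↧ₙ r) ℕ.* b ^ ((↥ r) ⁻)
log b C .Above r = ∃[ c ] AtMost  C c × c ^ (↧ₙ r) ℕ.* b ^ ((↥ r) ⁻) ℕ.< b ^ ((↥ r) ⁺)

-- Division by a positive integer; the value at m = 0 is meaningless.
_÷_ : Cut → ℕ → Cut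
(x ÷ m) .Below r = Below x (r ℚ.* (+ m ℚ./ 1))
(x ÷ m) .Above r = Above x (r ℚ.* (+ m ℚ./ 1))

_⟶_ : (ℕ → Cut) → ℚᵘ → Set
x ⟶ l = ∀ ε → 0ℚᵘ ℚ.< ε → ∃[ N ] ∀ n → N ℕ.≤ n →
  Below (x n) (l ℚ.- ε) × Above (x n) (l ℚ.+ ε)

-- b is the size of the alphabet.
HasEntropy : ∀ {A} → ℕ → InfinitePicture A → ℚᵘ → Set
HasEntropy b p l = (λ n → log b (complexity p n n) ÷ (n ℕ.* n)) ⟶ l

{-# OPTIONS --safe #-}

-- Suppose q has no border in its bottom-left corner, so that no occurrence of q
-- overlaps another one lying weakly to its north-east.  The cell just right of
-- the top-right cell of an occurrence at (a , b) must then be covered by an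
-- occurrence at (a + w , b + j) with 0 ≤ j < h, and likewise there are
-- neighbours (a + i , b + h), (a - w , b - j′) and (a - i′ , b - h).  Going right
-- and going up commute: besides (a , b), (a + w , b + j) and (a + i , b + h) there
-- is an occurrence at their parallelogram's fourth corner (a + w + i , b + h + j).
-- Hence the occurrences in a window are determined, by recursion from the left
-- and the bottom, by those in strips of bounded thickness along its sides, and
-- so is the picture.  Thus c(n , n) ≤ s ^ (4 K n) with K independent of n.  The
-- case of a bottom-right corner follows by mirroring the set of occurrences.

module Submission where

open import Defs
open import Data.Nat.Base using (ℕ; _≤_)
open import Data.Fin.Base using (Fin)
open import Data.Product.Base using (∃-syntax)
open import Data.Rational.Unnormalised.Base using (0ℚᵘ)
open import Function.Bundles using (_↔_)

open import Data.Empty using (⊥; ⊥-elim)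
open import Data.Fin.Base using (toℕ; fromℕ<; combine; remQuot; funToFin; finToFun)
open import Data.Fin.Patterns using (0F; 1F; 2F; 3F)
open import Data.Fin.Properties
  using (toℕ<n; toℕ-fromℕ<; remQuot-combine; finToFun-funToFin; injective⇒≤)
open import Data.Integer.Base as ℤ
  using (ℤ; +_; -[1+_]; +[1+_]; 0ℤ; 1ℤ; +≤+; _+_; _-_; -_; ∣_∣)
  renaming (_≤_ to _≤ᶻ_)
import Data.Integer.Properties as ℤₚ
open ℤₚ using
  (≤-refl; ≤-trans; ≤-antisym; <-irrefl; <⇒≤; ≰⇒>; +-mono-≤; +-monoʳ-≤; 0≤i-j⇒j≤i;
   i≤j⇒0≤j-i; i<j⇒suc[i]≤j; suc[i]≤j⇒i<j; neg-involutive; neg-injective; neg-mono-≤;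
   +-identityʳ; +-assoc; 0≤i⇒+∣i∣≡i; i≤i+j; drop‿+≤+)
open import Data.Integer.Tactic.RingSolver using (solve)
open import Data.List.Base using (_∷_; [])
open import Data.Nat.Base as ℕ using (zero; suc; _∸_; _^_)
import Data.Nat.Properties as ℕₚ
import Data.Nat.Tactic.RingSolver as ℕ-Solver
open import Data.Product.Base using (Σ-syntax; _×_; _,_; proj₁; proj₂)
open import Data.Rational.Unnormalised.Base as ℚ using (mkℚᵘ; ↥_; ↧ₙ_; *<*)
open import Data.Sum.Base using (_⊎_; inj₁; inj₂; [_,_]′)
open import Data.Vec.Base using (Vec; tabulate; lookup)
open import Data.Vec.Properties using (lookup∘tabulate; tabulate∘lookup; tabulate-cong)
open import Function.Base using (_∘_)
open import Function.Bundles using (_↣_; Injection)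
open import Function.Properties.Inverse using (↔⇒↣)
open import Relation.Binary.PropositionalEquality
open import Relation.Nullary using (yes; no)

-- Strict and weak inequalities between integers

infix 4 _≺_
-- Strictness is spelled out as a weak inequality, so that strict and weak hypotheses add up alike,
-- each strict one contributing its `1ℤ`.
_≺_ : ℤ → ℤ → Set
x ≺ y = 1ℤ + x ≤ᶻ y

-- Linear inequalities are derived by adding up hypotheses with _⊞_ and then
-- comparing the differences of the two sides with the ring solver.
infixl 6 _⊞_
_⊞_ : ∀ {i j k l} → i ≤ᶻ j → k ≤ᶻ l → i + k ≤ᶻ j + l
_⊞_ = +-mono-≤

abstract
  by : ∀ {i j k l} → i ≤ᶻ j → j - i ≡ l - k → k ≤ᶻ l
  by i≤j e = 0≤i-j⇒j≤i (subst (0ℤ ≤ᶻ_) e (i≤j⇒0≤j-i i≤j))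

  irreflexive : ∀ {x y} → x ≡ y → x ≺ y → ⊥
  irreflexive refl x≺x = <-irrefl refl (suc[i]≤j⇒i<j x≺x)

  ≺⇒≤ : ∀ {x y} → x ≺ y → x ≤ᶻ y
  ≺⇒≤ x≺y = <⇒≤ (suc[i]≤j⇒i<j x≺y)

  ≤-or-≻ : ∀ x y → x ≤ᶻ y ⊎ y ≺ x
  ≤-or-≻ x y with x ℤₚ.≤? y
  ... | yes x≤y = inj₁ x≤y
  ... | no  x≰y = inj₂ (i<j⇒suc[i]≤j (≰⇒> x≰y))

infix 4 _∈[_,+_]
_∈[_,+_] : ℤ → ℤ → ℤ → Set
x ∈[ a ,+ n ] = a ≤ᶻ x × x ≺ a + n

-- Sparse and covering sets of positions, and their symmetries

Region : Set₁
Region = ℤ → ℤ → Set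

-- P is thought of as the set of positions of a W × H block.
Sparse : ℤ → ℤ → Region → Set
Sparse W H P = ∀ {a b c d} → P a b → P c d → c ∈[ a ,+ W ] → d ∈[ b ,+ H ] →
               a ≡ c × b ≡ d

Covering : ℤ → ℤ → Region → Set
Covering W H P = ∀ x y → ∃[ c ] ∃[ d ] P c d × x ∈[ c ,+ W ] × y ∈[ d ,+ H ]

transposed rotated mirrored : Region → Region
transposed P x y = P y x
rotated    P x y = P (- x) (- y)
mirrored   P x y = P (- x) y

private variable
  W H : ℤ
  P   : Region

Sized : ℤ → ℤ → Set
Sized W H = 0ℤ ≺ W × 0ℤ ≺ H

-- Abstract, since with-abstraction over these lemmas would otherwise normalise
-- the proof terms of the ring solver.
abstract
  transposed-sparse : Sparse W H P → Sparse H W (transposed P)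
  transposed-sparse sparse p p′ x y with sparse p p′ y x
  ... | e , e′ = e′ , e

  transposed-covering : Covering W H P → Covering H W (transposed P)
  transposed-covering cover x y with cover y x
  ... | c , d , p , c∋y , d∋x = d , c , p , d∋x , c∋y

  -- Negation keeps distances but reverses order, so the point and the left end trade places.
  -- Sparsity of a rotated region therefore uses the two occurrences in the opposite order.
  ∈-neg : ∀ {x a n} → x ∈[ a ,+ n ] → - a ∈[ - x ,+ n ]
  ∈-neg {x} {a} {n} (a≤x , x<a+n) =
    by a≤x (solve (x ∷ a ∷ [])) , by x<a+n (solve (x ∷ a ∷ n ∷ []))

  -- In a reflected coordinate an occurrence is known by its opposite edge, so a
  -- cell is covered where the cell W - 1 steps away from its image was.
  reflected-cell : ∀ {x a n} → - x + n - 1ℤ ∈[ a ,+ n ] → x ∈[ - a ,+ n ]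
  reflected-cell {x} {a} {n} (l , r) =
    by r (solve (x ∷ a ∷ n ∷ [])) , by l (solve (x ∷ a ∷ n ∷ []))

  rotated-sparse : Sparse W H P → Sparse W H (rotated P)
  rotated-sparse sparse p p′ x y with sparse p′ p (∈-neg x) (∈-neg y)
  ... | e , e′ = sym (neg-injective e) , sym (neg-injective e′)

  rotated-covering : Covering W H P → Covering W H (rotated P)
  rotated-covering {W} {H} {P} cover x y with cover (- x + W - 1ℤ) (- y + H - 1ℤ)
  ... | c , d , p , c∋x , d∋y =
    - c , - d , subst₂ P (sym (neg-involutive c)) (sym (neg-involutive d)) p ,
    reflected-cell c∋x , reflected-cell d∋y

  -- Covering survives a mirror image, whereas sparsity distinguishes the two diagonals and in
  -- general does not; for mirrored occurrences it comes from the bottom-right corner instead.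
  mirrored-covering : Covering W H P → Covering W H (mirrored P)
  mirrored-covering {W} {H} {P} cover x y with cover (- x + W - 1ℤ) y
  ... | c , d , p , c∋x , d∋y =
    - c , d , subst (λ c → P c d) (sym (neg-involutive c)) p , reflected-cell c∋x , d∋y

  -- Neighbouring occurrences

  right-neighbour : Sized W H → Sparse W H P → Covering W H P →
    ∀ {a b} → P a b → ∃[ d ] d ∈[ b ,+ H ] × P (a + W) d
  right-neighbour {W} {H} {P} (0<W , 0<H) sparse cover {a} {b} p
    with cover (a + W) (b + H - 1ℤ)
  ... | c , d , p′ , (l , r) , (l′ , r′) with ≤-or-≻ (a + W) c
  ...   | inj₁ a+W≤c = d , d∈ , subst (λ c → P c d) (≤-antisym l a+W≤c) p′
    where
    d∈ : d ∈[ b ,+ H ]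
    d∈ = by r′ (solve (b ∷ d ∷ H ∷ [])) , by l′ (solve (b ∷ d ∷ H ∷ []))
  -- A covering occurrence starting before `a + W` would have its corner inside the occurrence at
  -- `(a , b)` yet different from `(a , b)`, against sparsity.
  ...   | inj₂ c<a+W =
    ⊥-elim (irreflexive (proj₁ (sparse p p′ (≺⇒≤ a<c , c<a+W) d∈)) a<c)
    where
    a<c : a ≺ c
    a<c = by r (solve (a ∷ c ∷ W ∷ []))
    d∈ : d ∈[ b ,+ H ]
    d∈ = by r′ (solve (b ∷ d ∷ H ∷ [])) , by l′ (solve (b ∷ d ∷ H ∷ []))

  upper-neighbour : Sized W H → Sparse W H P → Covering W H P →
    ∀ {a b} → P a b → ∃[ c ] c ∈[ a ,+ W ] × P c (b + H)
  upper-neighbour (0<W , 0<H) sparse cover =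
    right-neighbour (0<H , 0<W) (transposed-sparse sparse) (transposed-covering cover)

  neg-+ : ∀ x n → - (- x + n) ≡ x - n
  neg-+ x n = solve (x ∷ n ∷ [])

module _ (sized : Sized W H) (sparse : Sparse W H P) (cover : Covering W H P) where

  abstract
    private
      rotate : ∀ {x y} → P x y → rotated P (- x) (- y)
      rotate {x} {y} = subst₂ P (sym (neg-involutive x)) (sym (neg-involutive y))

      ∈-unneg : ∀ {x a n} → x ∈[ - a ,+ n ] → a ∈[ - x ,+ n ]
      ∈-unneg {x} {a} {n} m = subst (_∈[ - x ,+ n ]) (neg-involutive a) (∈-neg m)

    -- A half turn preserves sparsity and exchanges right with left. It also reverses the interval
    -- condition, so the left neighbour sits at height `b` or below.
    left-neighbour : ∀ {a b} → P a b → ∃[ d ] b ∈[ d ,+ H ] × P (a - W) d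
    left-neighbour {a} {b} p
      with right-neighbour sized (rotated-sparse sparse) (rotated-covering cover) (rotate p)
    ... | d , d∈ , p′ = - d , ∈-unneg d∈ , subst (λ x → P x (- d)) (neg-+ a W) p′

    lower-neighbour : ∀ {a b} → P a b → ∃[ c ] a ∈[ c ,+ W ] × P c (b - H)
    lower-neighbour {a} {b} p
      with upper-neighbour sized (rotated-sparse sparse) (rotated-covering cover) (rotate p)
    ... | c , c∈ , p′ = - c , ∈-unneg c∈ , subst (P (- c)) (neg-+ b H) p′

  -- The right neighbour of the upper neighbour is forced to the height d + H:
  -- if lower, it overlaps the right neighbour; if higher, its own lower
  -- neighbour overlaps the right neighbour or the initial occurrence.
  fourth-corner : ∀ {a b c d} → P a b →
    d ∈[ b ,+ H ] → P (a + W) d → c ∈[ a ,+ W ] → P c (b + H) →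
    P (c + W) (d + H)
  fourth-corner {a} {b} {c} {d} o (b≤d , d<b+H) r (a≤c , c<a+W) u
    with right-neighbour sized sparse cover u
  ... | e , (b+H≤e , e<) , s with ≤-or-≻ e (d + H) | ≤-or-≻ (d + H) e
  ...   | inj₁ e≤ | inj₁ ≤e = subst (P (c + W)) (≤-antisym e≤ ≤e) s
  ...   | inj₁ _  | inj₂ e<d+H =
    ⊥-elim (irreflexive (proj₂ (sparse r s c+W∈ (≺⇒≤ d<e , e<d+H))) d<e)
    where
    c+W∈ : c + W ∈[ a + W ,+ W ]
    c+W∈ = by a≤c (solve (a ∷ c ∷ W ∷ [])) , by c<a+W (solve (a ∷ c ∷ W ∷ []))
    d<e : d ≺ e
    d<e = by (d<b+H ⊞ b+H≤e) (solve (b ∷ d ∷ e ∷ H ∷ []))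
  ...   | inj₂ d+H<e | _         with lower-neighbour s
  ...     | f , (f≤ , <f) , s′ with ≤-or-≻ (a + W) f
  ...       | inj₁ a+W≤f = ⊥-elim (irreflexive (proj₂ (sparse r s′ f∈ (≺⇒≤ d<e-H , e-H<))) d<e-H)
    where
    f∈ : f ∈[ a + W ,+ W ]
    f∈ = a+W≤f , by (f≤ ⊞ c<a+W) (solve (a ∷ c ∷ f ∷ W ∷ []))
    d<e-H : d ≺ e - H
    d<e-H = by d+H<e (solve (d ∷ e ∷ H ∷ []))
    e-H< : e - H ≺ d + H
    e-H< = by (e< ⊞ b≤d) (solve (b ∷ d ∷ e ∷ H ∷ []))
  ...       | inj₂ f<a+W = ⊥-elim (irreflexive (proj₁ (sparse o s′ (≺⇒≤ a<f , f<a+W) e-H∈)) a<f)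
    where
    a<f : a ≺ f
    a<f = by (a≤c ⊞ <f) (solve (a ∷ c ∷ f ∷ W ∷ []))
    e-H∈ : e - H ∈[ b ,+ H ]
    e-H∈ = by b+H≤e (solve (b ∷ e ∷ H ∷ [])) , by e< (solve (b ∷ e ∷ H ∷ []))

-- Occurrences determined by those near the frame of a window

module _ (sized : Sized W H) (sparse : Sparse W H P) (cover : Covering W H P) where

  -- This is `fourth-corner` after a half turn. It completes a parallelogram with top vertex
  -- `(x , y)`, from whose other three vertices `fourth-corner` recovers `(x , y)`.
  lower-left-neighbours : ∀ {x y} → P x y → ∃[ c ] ∃[ d ]
    P (x - W) d × y ∈[ d ,+ H ] × P c (y - H) × x ∈[ c ,+ W ] × P (c - W) (d - H)
  lower-left-neighbours {x} {y} p
    with left-neighbour sized sparse cover p | lower-neighbour sized sparse cover p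
  ... | d , d∋y , l | c , c∋x , u =
    c , d , l , d∋y , u , c∋x ,
    subst₂ P (neg-+ c W) (neg-+ d H)
      (fourth-corner sized (rotated-sparse sparse) (rotated-covering cover)
        (subst₂ P (sym (neg-involutive x)) (sym (neg-involutive y)) p)
        (∈-neg d∋y) (subst₂ P (sym (neg-+ x W)) (sym (neg-involutive d)) l)
        (∈-neg c∋x) (subst₂ P (sym (neg-involutive c)) (sym (neg-+ y H)) u))

-- Two windows are compared by translating one onto the other by (s , t).
FrameDetermined : ℤ → ℤ → Region → Set
FrameDetermined W H P = ∀ {s t x₀ y₀ X Y} →
  (∀ {x y} → x₀ ≤ᶻ x × x ≤ᶻ X → y₀ ≤ᶻ y × y ≤ᶻ Y →
     x ≺ x₀ + (W + W) ⊎ X ≺ x + (W + W) ⊎ y ≺ y₀ + (H + H) →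
     P x y → P (x + s) (y + t)) →
  ∀ {x y} → x₀ ≤ᶻ x × x ≤ᶻ X → y₀ ≤ᶻ y × y ≤ᶻ Y → P x y → P (x + s) (y + t)

-- Since `c` exceeds `x - n`, the farthest predecessor `c - n` exceeds `x - 2n`; a distance of `2n`
-- from the start thus keeps all three inside the window.
backward : ∀ {x₀ X x c n} → 0ℤ ≺ n → x₀ ≤ᶻ x × x ≤ᶻ X → x₀ + (n + n) ≤ᶻ x → x ∈[ c ,+ n ] →
  (x₀ ≤ᶻ c - n × c - n ≤ᶻ X) × (x₀ ≤ᶻ c × c ≤ᶻ X) × (x₀ ≤ᶻ x - n × x - n ≤ᶻ X)
backward {x₀} {X} {x} {c} {n} 0<n (_ , x≤X) x₀+2n≤x (c≤x , x<c+n) =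
  (x₀≤c-n , ≤-trans (≤-trans c-n≤x-n x-n≤x) x≤X) ,
  (≤-trans x₀≤c-n c-n≤c , ≤-trans c≤x x≤X) ,
  (≤-trans x₀≤c-n c-n≤x-n , ≤-trans x-n≤x x≤X)
  where
  x₀≤c-n : x₀ ≤ᶻ c - n
  x₀≤c-n = ≺⇒≤ (by (x₀+2n≤x ⊞ x<c+n) (solve (x₀ ∷ x ∷ c ∷ n ∷ [])))
  c-n≤c : c - n ≤ᶻ c
  c-n≤c = by (≺⇒≤ {0ℤ} 0<n) (solve (c ∷ n ∷ []))
  x-n≤x : x - n ≤ᶻ x
  x-n≤x = by (≺⇒≤ {0ℤ} 0<n) (solve (x ∷ n ∷ []))
  c-n≤x-n : c - n ≤ᶻ x - n
  c-n≤x-n = by c≤x (solve (x ∷ c ∷ n ∷ []))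

minus-≺ : ∀ {x} c n → 0ℤ ≺ n → c ≤ᶻ x → c - n ≺ x
minus-≺ {x} c n 0<n c≤x = by (0<n ⊞ c≤x) (solve (x ∷ c ∷ n ∷ []))

sum-decreases : ∀ {x y m k} x′ y′ → x′ ≤ᶻ x → y′ ≤ᶻ y → x′ ≺ x ⊎ y′ ≺ y →
  x + y - m ≺ 1ℤ + k → x′ + y′ - m ≺ k
sum-decreases {x} {y} {m} {k} x′ y′ _ y′≤y (inj₁ x′<x) small =
  by (x′<x ⊞ y′≤y ⊞ small) (solve (x ∷ x′ ∷ y ∷ y′ ∷ m ∷ k ∷ []))
sum-decreases {x} {y} {m} {k} x′ y′ x′≤x _ (inj₂ y′<y) small =
  by (x′≤x ⊞ y′<y ⊞ small) (solve (x ∷ x′ ∷ y ∷ y′ ∷ m ∷ k ∷ []))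

translate-∈ : ∀ {x c n} s → x ∈[ c ,+ n ] → x - n + s ∈[ c - n + s ,+ n ]
translate-∈ {x} {c} {n} s (c≤x , x<c+n) =
  by c≤x (solve (x ∷ c ∷ n ∷ s ∷ [])) , by x<c+n (solve (x ∷ c ∷ n ∷ s ∷ []))

-+-+ : ∀ x n s → x - n + s + n ≡ x + s
-+-+ x n s = solve (x ∷ n ∷ s ∷ [])

-- Induction on the distance `x + y - (x₀ + y₀)` from the bottom-left corner of the window. Off the
-- frame, the three lower-left neighbours lie in the window at smaller distance, so their translates
-- are in `P` and force the translate of `(x , y)`.
frame-determined : Sized W H → Sparse W H P → Covering W H P → FrameDetermined W H P
frame-determined {W} {H} {P} sized@(0<W , 0<H) sparse cover {s} {t} {x₀} {y₀} {X} {Y} frame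
  {x} {y} x∈ y∈ =
  -- The bound carried by the induction is strict, hence one more than the distance.
  induct (suc ∣ x + y - (x₀ + y₀) ∣) x∈ y∈
    (subst (λ m → 1ℤ + (x + y - (x₀ + y₀)) ≤ᶻ 1ℤ + m) (sym (0≤i⇒+∣i∣≡i measure≥0)) ≤-refl)
  where
  measure≥0 : 0ℤ ≤ᶻ x + y - (x₀ + y₀)
  measure≥0 = i≤j⇒0≤j-i (proj₁ x∈ ⊞ proj₁ y∈)

  induct : ∀ k {x y} → x₀ ≤ᶻ x × x ≤ᶻ X → y₀ ≤ᶻ y × y ≤ᶻ Y → x + y - (x₀ + y₀) ≺ + k →
           P x y → P (x + s) (y + t)
  step : ∀ k {x y} → x₀ ≤ᶻ x × x ≤ᶻ X → y₀ ≤ᶻ y × y ≤ᶻ Y → x + y - (x₀ + y₀) ≺ 1ℤ + + k →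
         x₀ + (W + W) ≤ᶻ x → y₀ + (H + H) ≤ᶻ y → P x y → P (x + s) (y + t)

  induct zero {x} {y} (x₀≤x , _) (y₀≤y , _) m _ =
    ⊥-elim (irreflexive refl (≤-trans m (i≤j⇒0≤j-i (x₀≤x ⊞ y₀≤y))))
  induct (suc k) {x} {y} x∈ y∈ m p =
    [ (λ x₀+2W≤x → [ (λ y₀+2H≤y → step k x∈ y∈ m x₀+2W≤x y₀+2H≤y p)
                   , (λ y<y₀+2H → frame x∈ y∈ (inj₂ (inj₂ y<y₀+2H)) p) ]′
                   (≤-or-≻ (y₀ + (H + H)) y))
    , (λ x<x₀+2W → frame x∈ y∈ (inj₁ x<x₀+2W) p) ]′
    (≤-or-≻ (x₀ + (W + W)) x)

  step k {x} {y} x∈ y∈ m x₀+2W≤x y₀+2H≤y p =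
    let c , d , l , y∈d , u , x∈c , o = lower-left-neighbours sized sparse cover p
        c-W∈ , c∈ , x-W∈ = backward 0<W x∈ x₀+2W≤x x∈c
        d-H∈ , d∈ , y-H∈ = backward 0<H y∈ y₀+2H≤y y∈d
        x-W<x = minus-≺ x W 0<W ≤-refl
        y-H<y = minus-≺ y H 0<H ≤-refl
        c-W<x = minus-≺ c W 0<W (proj₁ x∈c)
        d-H<y = minus-≺ d H 0<H (proj₁ y∈d)
        smaller : ∀ x′ y′ → x′ ≤ᶻ x → y′ ≤ᶻ y → x′ ≺ x ⊎ y′ ≺ y → x′ + y′ - (x₀ + y₀) ≺ + k
        smaller x′ y′ x′≤x y′≤y strict = sum-decreases x′ y′ x′≤x y′≤y strict m
    -- Seen from the translate of `(c - W , d - H)`, the translate of `(c , y - H)` is the right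
    -- neighbour and that of `(x - W , d)` the upper one.
    in subst₂ P (-+-+ x W s) (-+-+ y H t)
         (fourth-corner sized sparse cover
           (induct k c-W∈ d-H∈
             (smaller (c - W) (d - H) (≺⇒≤ c-W<x) (≺⇒≤ d-H<y) (inj₁ c-W<x)) o)
           (translate-∈ t y∈d)
           (subst (λ z → P z (y - H + t)) (sym (-+-+ c W s))
             (induct k c∈ y-H∈
               (smaller c (y - H) (proj₁ x∈c) (≺⇒≤ y-H<y) (inj₂ y-H<y)) u))
           (translate-∈ s x∈c)
           (subst (P (x - W + s)) (sym (-+-+ d H t))
             (induct k x-W∈ d∈
               (smaller (x - W) d (≺⇒≤ x-W<x) (proj₁ y∈d) (inj₁ x-W<x)) l)))

-- Mirroring turns the range from `x₀` to `X` into that from `- X` to `- x₀` and the shift `s` into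
-- `- s`. The left and right parts of the frame change places, which is why the frame has both.
mirrored-frame-determined : FrameDetermined W H (mirrored P) → FrameDetermined W H P
mirrored-frame-determined {W} {H} {P} determined {s} {t} {x₀} {y₀} {X} {Y} frame
  {x} {y} (x₀≤x , x≤X) y∈ p =
  subst (λ z → P z (y + t)) (neg-neg-+-neg x)
    (determined {s = - s} {X = - x₀} frame′ (neg-mono-≤ x≤X , neg-mono-≤ x₀≤x) y∈
      (subst (λ z → P z y) (sym (neg-involutive x)) p))
  where
  neg-neg-+-neg : ∀ x → - (- x + - s) ≡ x + s
  neg-neg-+-neg x = solve (x ∷ s ∷ [])
  neg-+-neg : ∀ x → - x + s ≡ - (x + - s)
  neg-+-neg x = solve (x ∷ s ∷ [])
  swap : ∀ {x} → x ≺ - X + (W + W) → X ≺ - x + (W + W)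
  swap {x} x< = by x< (solve (x ∷ X ∷ W ∷ []))
  swap′ : ∀ {x} → - x₀ ≺ x + (W + W) → - x ≺ x₀ + (W + W)
  swap′ {x} x> = by x> (solve (x ∷ x₀ ∷ W ∷ []))
  frame′ : ∀ {x y} → - X ≤ᶻ x × x ≤ᶻ - x₀ → y₀ ≤ᶻ y × y ≤ᶻ Y →
    x ≺ - X + (W + W) ⊎ - x₀ ≺ x + (W + W) ⊎ y ≺ y₀ + (H + H) →
    mirrored P x y → mirrored P (x + - s) (y + t)
  frame′ {x} {y} (-X≤x , x≤-x₀) y∈ near p =
    subst (λ z → P z (y + t)) (neg-+-neg x)
      (frame (subst (_≤ᶻ - x) (neg-involutive x₀) (neg-mono-≤ x≤-x₀) ,
              subst (- x ≤ᶻ_) (neg-involutive X) (neg-mono-≤ -X≤x))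
             y∈ (near′ near) p)
    where
    near′ : x ≺ - X + (W + W) ⊎ - x₀ ≺ x + (W + W) ⊎ y ≺ y₀ + (H + H) →
            - x ≺ x₀ + (W + W) ⊎ X ≺ - x + (W + W) ⊎ y ≺ y₀ + (H + H)
    near′ (inj₁ l)        = inj₂ (inj₁ (swap {x} l))
    near′ (inj₂ (inj₁ r)) = inj₁ (swap′ {x} r)
    near′ (inj₂ (inj₂ b)) = inj₂ (inj₂ b)

-- From borders of `q` to overlaps of its occurrences

∈⇒offset : ∀ {x a n} → x ∈[ a ,+ + n ] → Σ[ i ∈ Fin n ] x ≡ a + + toℕ i
∈⇒offset {x} {a} {n} (a≤x , x<a+n) = fromℕ< k<n , (begin
  x                        ≡⟨ plus-minus a x ⟨
  a + (x - a)              ≡⟨ cong (λ k → a + k) k≡ ⟨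
  a + + ∣ x - a ∣          ≡⟨ cong (λ k → a + + k) (toℕ-fromℕ< k<n) ⟨
  a + + toℕ (fromℕ< k<n)   ∎)
  where
  open ≡-Reasoning
  plus-minus : ∀ a x → a + (x - a) ≡ x
  plus-minus a x = solve (a ∷ x ∷ [])
  k≡ : + ∣ x - a ∣ ≡ x - a
  k≡ = 0≤i⇒+∣i∣≡i (i≤j⇒0≤j-i a≤x)
  shift : ∀ {m} → x ≺ a + m → x - a ≺ m
  shift {m} x<a+m = by x<a+m (solve (a ∷ x ∷ m ∷ []))
  k<n : ∣ x - a ∣ ℕ.< n
  k<n = drop‿+≤+ (subst (_≺ + n) (sym k≡) (shift x<a+n))

offset⇒∈ : ∀ a {n} (i : Fin n) → a + + toℕ i ∈[ a ,+ + n ]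
offset⇒∈ a {n} i = i≤i+j a (+ toℕ i) ,
  subst (_≤ᶻ a + + n) (rearrange (+ toℕ i)) (+-monoʳ-≤ a (+≤+ (toℕ<n i)))
  where
  rearrange : ∀ k → a + (1ℤ + k) ≡ 1ℤ + (a + k)
  rearrange k = solve (a ∷ k ∷ [])

∸≡⇒≡0 : ∀ {m n} → n ℕ.≤ m → m ∸ n ≡ m → n ≡ 0
∸≡⇒≡0 {m} {n} n≤m e = begin
  n             ≡⟨ ℕₚ.m∸[m∸n]≡n n≤m ⟨
  m ∸ (m ∸ n)   ≡⟨ cong (m ∸_) e ⟩
  m ∸ m         ≡⟨ ℕₚ.n∸n≡0 m ⟩
  0             ∎
  where open ≡-Reasoning

window : ∀ {A} → InfinitePicture A → ℤ → ℤ → (w h : ℕ) → Block A w h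
window p x y w h = tabulate λ j → tabulate λ i → p (x + + toℕ i) (y + + toℕ j)

cell-window : ∀ {A} (p : InfinitePicture A) x y {w h} (i : Fin w) (j : Fin h) →
  cell (window p x y w h) i j ≡ p (x + + toℕ i) (y + + toℕ j)
cell-window p x y i j =
  trans (cong (λ row → lookup row i) (lookup∘tabulate _ j)) (lookup∘tabulate _ i)

module _ {A : Set} {w h : ℕ} (q : Block A w h) where

  swap-corners : ∀ {k} → WithoutNonEmptyBorder q (opposite k) → WithoutNonEmptyBorder q k
  swap-corners {k} borderless w′ h′ 1≤w′ 1≤h′ u border = borderless w′ h′ 1≤w′ 1≤h′ u record
    { proper      = proper
    ; at-corner   = at-opposite
    ; at-opposite = subst (λ k → OccursInCorner k u q) (sym (involutive k)) at-corner
    }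
    where
    open IsBorder border
    involutive : ∀ k → opposite (opposite k) ≡ k
    involutive bottomLeft  = refl
    involutive bottomRight = refl
    involutive topLeft     = refl
    involutive topRight    = refl

  -- A non-zero offset would make `u` differ from `q` in size, and the bounds on `i` and `j` make it
  -- non-empty, so it would be a border.
  overlap-trivial : ∀ k → WithoutNonEmptyBorder q k → ∀ {i j} → i ℕ.< w → j ℕ.< h →
    (u : Block A (w ∸ i) (h ∸ j)) → OccursInCorner k u q → OccursInCorner (opposite k) u q →
    i ≡ 0 × j ≡ 0
  overlap-trivial k borderless {i} {j} i<w j<h u at-k at-k′ with i ℕₚ.≟ 0 | j ℕₚ.≟ 0
  ... | yes i≡0 | yes j≡0 = i≡0 , j≡0
  ... | no  i≢0 | _       = ⊥-elim (borderless _ _ (ℕₚ.m<n⇒0<n∸m i<w) (ℕₚ.m<n⇒0<n∸m j<h) u record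
    { proper      = i≢0 ∘ ∸≡⇒≡0 (ℕₚ.<⇒≤ i<w) ∘ cong proj₁
    ; at-corner   = at-k
    ; at-opposite = at-k′
    })
  ... | yes _   | no  j≢0 = ⊥-elim (borderless _ _ (ℕₚ.m<n⇒0<n∸m i<w) (ℕₚ.m<n⇒0<n∸m j<h) u record
    { proper      = j≢0 ∘ ∸≡⇒≡0 (ℕₚ.<⇒≤ j<h) ∘ cong (proj₁ ∘ proj₂)
    ; at-corner   = at-k
    ; at-opposite = at-k′
    })

  module _ (p : InfinitePicture A) where

    window-occurs : ∀ c d a b w′ h′ {x y} → OccursAtℤ² q p c d →
      c + + a ≡ x → d + + b ≡ y → a ℕ.+ w′ ℕ.≤ w → b ℕ.+ h′ ℕ.≤ h →
      OccursAt (window p x y w′ h′) q a b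
    window-occurs c d a b w′ h′ occurs refl refl a+w′≤w b+h′≤h = record
      { fits-width  = a+w′≤w
      ; fits-height = b+h′≤h
      ; agrees      = λ i j i′ j′ i≡ j≡ → begin
          cell q i j
            ≡⟨ occurs i j ⟨
          p (c + + toℕ i) (d + + toℕ j)
            ≡⟨ cong₂ p (shift c i≡) (shift d j≡) ⟩
          p (c + + a + + toℕ i′) (d + + b + + toℕ j′)
            ≡⟨ cell-window p (c + + a) (d + + b) i′ j′ ⟨
          cell (window p (c + + a) (d + + b) w′ h′) i′ j′ ∎
      }
      where
      open ≡-Reasoning
      shift : ∀ x {k a l} → k ≡ a ℕ.+ l → x + + k ≡ x + + a + + l
      shift x {a = a} {l} refl = sym (+-assoc x (+ a) (+ l))

    occurrences-covering : Coverable q p → Covering (+ w) (+ h) (OccursAtℤ² q p)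
    occurrences-covering cover x y with cover x y
    ... | a , b , occurs , (i , refl) , (j , refl) =
      a , b , occurs , offset⇒∈ a i , offset⇒∈ b j

    private
      -- n ∸ (n ∸ i) is the offset at which an interval of length n ∸ i ends at n.
      flush : ∀ {n} (i : Fin n) → toℕ i ≡ n ∸ (n ∸ toℕ i)
      flush i = sym (ℕₚ.m∸[m∸n]≡n (ℕₚ.<⇒≤ (toℕ<n i)))

      fits : ∀ {n} (i : Fin n) → toℕ i ℕ.+ (n ∸ toℕ i) ℕ.≤ n
      fits i = ℕₚ.≤-reflexive (ℕₚ.m+[n∸m]≡n (ℕₚ.<⇒≤ (toℕ<n i)))

      zero-offset : ∀ {k} x → k ≡ 0 → x ≡ x + + k
      zero-offset x refl = sym (+-identityʳ x)

    -- The overlap of the two occurrences is the bottom-left part of the one at `(c , d)` and the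
    -- top-right part of the one at `(a , b)`.
    occurrences-sparse : WithoutNonEmptyBorder q bottomLeft →
      Sparse (+ w) (+ h) (OccursAtℤ² q p)
    occurrences-sparse borderless {a} {b} {c} {d} o o′ c∈ d∈ =
      conclude (∈⇒offset c∈) (∈⇒offset d∈)
      where
      conclude : Σ[ i ∈ Fin w ] c ≡ a + + toℕ i → Σ[ j ∈ Fin h ] d ≡ b + + toℕ j → a ≡ c × b ≡ d
      conclude (i , refl) (j , refl) =
        let w′ = w ∸ toℕ i
            h′ = h ∸ toℕ j
            u = window p c d w′ h′
            i≡0 , j≡0 = overlap-trivial bottomLeft borderless (toℕ<n i) (toℕ<n j) u
              (window-occurs c d 0 0 w′ h′ o′ (+-identityʳ c) (+-identityʳ d)
                (ℕₚ.m∸n≤m w (toℕ i)) (ℕₚ.m∸n≤m h (toℕ j)))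
              (subst₂ (OccursAt u q) (flush i) (flush j)
                (window-occurs a b (toℕ i) (toℕ j) w′ h′ o refl refl (fits i) (fits j)))
        in zero-offset a i≡0 , zero-offset b j≡0

    -- Here the occurrences are at `(- a , b)` and `(- c , d)`; their overlap is the bottom-right
    -- part of the latter and the top-left part of the former.
    mirrored-occurrences-sparse : WithoutNonEmptyBorder q bottomRight →
      Sparse (+ w) (+ h) (mirrored (OccursAtℤ² q p))
    mirrored-occurrences-sparse borderless {a} {b} {c} {d} o o′ c∈ d∈ =
      conclude (∈⇒offset c∈) (∈⇒offset d∈)
      where
      -c+k≡-a : ∀ k → - (a + k) + k ≡ - a
      -c+k≡-a k = solve (a ∷ k ∷ [])
      conclude : Σ[ i ∈ Fin w ] c ≡ a + + toℕ i → Σ[ j ∈ Fin h ] d ≡ b + + toℕ j → a ≡ c × b ≡ d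
      conclude (i , refl) (j , refl) =
        let w′ = w ∸ toℕ i
            h′ = h ∸ toℕ j
            u = window p (- a) d w′ h′
            i≡0 , j≡0 = overlap-trivial bottomRight borderless (toℕ<n i) (toℕ<n j) u
              (subst (λ x → OccursAt u q x 0) (flush i)
                (window-occurs (- c) d (toℕ i) 0 w′ h′ o′ (-c+k≡-a (+ toℕ i)) (+-identityʳ d)
                  (fits i) (ℕₚ.m∸n≤m h (toℕ j))))
              (subst (OccursAt u q 0) (flush j)
                (window-occurs (- a) b 0 (toℕ j) w′ h′ o (+-identityʳ (- a)) refl
                  (ℕₚ.m∸n≤m w (toℕ i)) (fits j)))
        in zero-offset a i≡0 , zero-offset b j≡0

    occurrences-determined : Sized (+ w) (+ h) → Coverable q p → ∀ k → WithoutNonEmptyBorder q k →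
      FrameDetermined (+ w) (+ h) (OccursAtℤ² q p)
    occurrences-determined sized cover bottomLeft borderless =
      frame-determined sized (occurrences-sparse borderless) (occurrences-covering cover)
    occurrences-determined sized cover bottomRight borderless =
      mirrored-frame-determined {+ w} {+ h}
        (frame-determined sized (mirrored-occurrences-sparse borderless)
          (mirrored-covering (occurrences-covering cover)))
    -- Borders at a corner and at its opposite are the same blocks, so the top corners reduce to the
    -- bottom ones.
    occurrences-determined sized cover topLeft borderless =
      occurrences-determined sized cover bottomRight (swap-corners borderless)
    occurrences-determined sized cover topRight borderless =
      occurrences-determined sized cover bottomLeft (swap-corners borderless)

-- Letters of a window determined by those near its sides

NearSides : ℤ → ℤ → ℤ → ℤ → Set
NearSides K x₀ n x = x ≺ x₀ + K ⊎ x₀ + n ≤ᶻ x + K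

near-sides? : ∀ K x₀ n x → NearSides K x₀ n x ⊎ (x₀ + K ≤ᶻ x × x + K ≺ x₀ + n)
near-sides? K x₀ n x =
  [ (λ x₀+K≤x → [ (λ x₀+n≤x+K → inj₁ (inj₂ x₀+n≤x+K)) , (λ x+K<x₀+n → inj₂ (x₀+K≤x , x+K<x₀+n)) ]′
                (≤-or-≻ (x₀ + n) (x + K)))
  , (λ x<x₀+K → inj₁ (inj₁ x<x₀+K)) ]′
  (≤-or-≻ (x₀ + K) x)

inner-occurrence : ∀ {K x₀ n x c W} → W ≤ᶻ K → x₀ + K ≤ᶻ x → x + K ≺ x₀ + n → x ∈[ c ,+ W ] →
  x₀ ≤ᶻ c × c ≤ᶻ x₀ + n - W
inner-occurrence {K} {x₀} {n} {x} {c} {W} W≤K x₀+K≤x x+K<x₀+n (c≤x , x<c+W) =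
  ≺⇒≤ (by (x₀+K≤x ⊞ x<c+W ⊞ W≤K) (solve (K ∷ x₀ ∷ x ∷ c ∷ W ∷ []))) ,
  ≺⇒≤ (by (x+K<x₀+n ⊞ c≤x ⊞ W≤K) (solve (K ∷ x₀ ∷ n ∷ x ∷ c ∷ W ∷ [])))

inside-occurrence : ∀ {x₀ n x W} i → x₀ ≤ᶻ x × x ≤ᶻ x₀ + n - W →
  x + i ∈[ x ,+ W ] → x + i ∈[ x₀ ,+ n ]
inside-occurrence {x₀} {n} {x} {W} i (x₀≤x , x≤) (x≤x+i , x+i<) =
  ≤-trans x₀≤x x≤x+i , by (x≤ ⊞ x+i<) (solve (x₀ ∷ n ∷ x ∷ W ∷ i ∷ []))

near-start : ∀ {K x₀ x W} i → W + W + W ≤ᶻ K → x + i ∈[ x ,+ W ] → x ≺ x₀ + (W + W) → x + i ≺ x₀ + K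
near-start {K} {x₀} {x} {W} i 3W≤K (_ , x+i<) x< =
  ≺⇒≤ (by (3W≤K ⊞ x+i< ⊞ x<) (solve (K ∷ x₀ ∷ x ∷ W ∷ i ∷ [])))

near-end : ∀ {K x₀ n x W} i → W + W + W ≤ᶻ K → x + i ∈[ x ,+ W ] → x₀ + n - W ≺ x + (W + W) →
  x₀ + n ≤ᶻ x + i + K
near-end {K} {x₀} {n} {x} {W} i 3W≤K (x≤x+i , _) x> =
  ≺⇒≤ (by (3W≤K ⊞ x≤x+i ⊞ x>) (solve (K ∷ x₀ ∷ n ∷ x ∷ W ∷ i ∷ [])))

module _ {A : Set} {w h : ℕ} (q : Block A w h) (p : InfinitePicture A)
         (sized : Sized (+ w) (+ h)) (cover : Coverable q p)
         (k : Corner) (borderless : WithoutNonEmptyBorder q k)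
         {K : ℕ} (3w≤K : w ℕ.+ w ℕ.+ w ℕ.≤ K) (3h≤K : h ℕ.+ h ℕ.+ h ℕ.≤ K) where

  -- An occurrence starting within twice its size of a side lies wholly in the strip of thickness
  -- `K`, so it is translated along with its letters. A cell off the strips is covered by an
  -- occurrence inside the window, whose translate is again an occurrence and shows the same letter
  -- of `q`.
  picture-determined : ∀ {x₀ y₀ s t n} →
    (∀ {x y} → x ∈[ x₀ ,+ n ] → y ∈[ y₀ ,+ n ] →
       NearSides (+ K) x₀ n x ⊎ NearSides (+ K) y₀ n y → p x y ≡ p (x + s) (y + t)) →
    ∀ {x y} → x ∈[ x₀ ,+ n ] → y ∈[ y₀ ,+ n ] → p x y ≡ p (x + s) (y + t)
  picture-determined {x₀} {y₀} {s} {t} {n} agree {x} {y} x∈ y∈ =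
    [ (λ near-x → agree x∈ y∈ (inj₁ near-x))
    , (λ far-x → [ (λ near-y → agree x∈ y∈ (inj₂ near-y))
                 , (λ far-y → interior far-x far-y (occurrences-covering q p cover x y)) ]′
                 (near-sides? (+ K) y₀ n y)) ]′
    (near-sides? (+ K) x₀ n x)
    where
    +-swap : ∀ x i s → x + i + s ≡ x + s + i
    +-swap x i s = solve (x ∷ i ∷ s ∷ [])

    ≤3 : ∀ m → m ℕ.≤ m ℕ.+ m ℕ.+ m
    ≤3 m = ℕₚ.≤-trans (ℕₚ.m≤m+n m m) (ℕₚ.m≤m+n (m ℕ.+ m) m)

    frame : ∀ {x y} → x₀ ≤ᶻ x × x ≤ᶻ x₀ + n - + w → y₀ ≤ᶻ y × y ≤ᶻ y₀ + n - + h →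
      x ≺ x₀ + (+ w + + w) ⊎ x₀ + n - + w ≺ x + (+ w + + w) ⊎ y ≺ y₀ + (+ h + + h) →
      OccursAtℤ² q p x y → OccursAtℤ² q p (x + s) (y + t)
    frame {x} {y} x∈ y∈ near occurs i j = begin
      p (x + s + + toℕ i) (y + t + + toℕ j)
        ≡⟨ cong₂ p (+-swap x (+ toℕ i) s) (+-swap y (+ toℕ j) t) ⟨
      p (x + + toℕ i + s) (y + + toℕ j + t)
        ≡⟨ agree (inside-occurrence (+ toℕ i) x∈ i∈) (inside-occurrence (+ toℕ j) y∈ j∈)
                 (near′ near) ⟨
      p (x + + toℕ i) (y + + toℕ j)
        ≡⟨ occurs i j ⟩
      cell q i j ∎
      where
      open ≡-Reasoning
      i∈ = offset⇒∈ x i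
      j∈ = offset⇒∈ y j
      near′ : x ≺ x₀ + (+ w + + w) ⊎ x₀ + n - + w ≺ x + (+ w + + w) ⊎ y ≺ y₀ + (+ h + + h) →
        NearSides (+ K) x₀ n (x + + toℕ i) ⊎ NearSides (+ K) y₀ n (y + + toℕ j)
      near′ (inj₁ l)        = inj₁ (inj₁ (near-start {x₀ = x₀} {W = + w} (+ toℕ i) (+≤+ 3w≤K) i∈ l))
      near′ (inj₂ (inj₁ r)) =
        inj₁ (inj₂ (near-end {x₀ = x₀} {n = n} {W = + w} (+ toℕ i) (+≤+ 3w≤K) i∈ r))
      near′ (inj₂ (inj₂ b)) = inj₂ (inj₁ (near-start {x₀ = y₀} {W = + h} (+ toℕ j) (+≤+ 3h≤K) j∈ b))

    interior : ∀ {x y} → x₀ + + K ≤ᶻ x × x + + K ≺ x₀ + n → y₀ + + K ≤ᶻ y × y + + K ≺ y₀ + n →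
      ∃[ c ] ∃[ d ] OccursAtℤ² q p c d × x ∈[ c ,+ + w ] × y ∈[ d ,+ + h ] → p x y ≡ p (x + s) (y + t)
    interior {x} {y} (x₀+K≤x , x+K<) (y₀+K≤y , y+K<) (c , d , occurs , x∈c , y∈d) =
      conclude (∈⇒offset x∈c) (∈⇒offset y∈d)
      where
      open ≡-Reasoning
      occurs′ : OccursAtℤ² q p (c + s) (d + t)
      occurs′ = occurrences-determined q p sized cover k borderless frame
        (inner-occurrence (+≤+ (ℕₚ.≤-trans (≤3 w) 3w≤K)) x₀+K≤x x+K< x∈c)
        (inner-occurrence (+≤+ (ℕₚ.≤-trans (≤3 h) 3h≤K)) y₀+K≤y y+K< y∈d) occurs
      conclude : Σ[ i ∈ Fin w ] x ≡ c + + toℕ i → Σ[ j ∈ Fin h ] y ≡ d + + toℕ j →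
        p x y ≡ p (x + s) (y + t)
      conclude (i , refl) (j , refl) = begin
        p (c + + toℕ i) (d + + toℕ j)
          ≡⟨ occurs i j ⟩
        cell q i j
          ≡⟨ occurs′ i j ⟨
        p (c + s + + toℕ i) (d + t + + toℕ j)
          ≡⟨ cong₂ p (+-swap c (+ toℕ i) s) (+-swap d (+ toℕ j) t) ⟨
        p (c + + toℕ i + s) (d + + toℕ j + t) ∎

-- Counting blocks by the letters along their sides

cell-extensional : ∀ {A : Set} {w h} {u v : Block A w h} → (∀ i j → cell u i j ≡ cell v i j) → u ≡ v
cell-extensional {u = u} {v} same = lookup-extensional λ j → lookup-extensional λ i → same i j
  where
  lookup-extensional : ∀ {B : Set} {n} {xs ys : Vec B n} → (∀ i → lookup xs i ≡ lookup ys i) → xs ≡ ys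
  lookup-extensional {xs = xs} {ys} same =
    trans (sym (tabulate∘lookup xs)) (trans (tabulate-cong same) (tabulate∘lookup ys))

-- The four arguments 0F, 1F, 2F, 3F are the left, right, bottom and top sides;
-- k is the distance to the side and t the coordinate along it.
side-cell : ∀ {K n} → Fin 4 → Fin K → Fin n → ℕ × ℕ
side-cell     0F k t = toℕ k , toℕ t
side-cell {n = n} 1F k t = n ∸ suc (toℕ k) , toℕ t
side-cell     2F k t = toℕ t , toℕ k
side-cell {n = n} 3F k t = toℕ t , n ∸ suc (toℕ k)

module _ {A : Set} {s : ℕ} (A↣s : A ↣ Fin s) where

  encode : ∀ {m} → (Fin m → A) → Fin (s ^ m)
  encode f = funToFin (Injection.to A↣s ∘ f)

  encode-injective : ∀ {m} (f g : Fin m → A) → encode f ≡ encode g → ∀ i → f i ≡ g i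
  encode-injective f g e i = Injection.injective A↣s (begin
    Injection.to A↣s (f i)     ≡⟨ finToFun-funToFin (Injection.to A↣s ∘ f) i ⟨
    finToFun (encode f) i      ≡⟨ cong (λ c → finToFun c i) e ⟩
    finToFun (encode g) i      ≡⟨ finToFun-funToFin (Injection.to A↣s ∘ g) i ⟩
    Injection.to A↣s (g i)     ∎)
    where open ≡-Reasoning

  module _ {w h : ℕ} (q : Block A w h) (p : InfinitePicture A)
           (sized : Sized (+ w) (+ h)) (cover : Coverable q p)
           (k : Corner) (borderless : WithoutNonEmptyBorder q k)
           {K : ℕ} (3w≤K : w ℕ.+ w ℕ.+ w ℕ.≤ K) (3h≤K : h ℕ.+ h ℕ.+ h ℕ.≤ K) (n : ℕ) where

    private
      letter : ℤ → ℤ → ℕ × ℕ → A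
      letter x y (i , j) = p (x + + i) (y + + j)

      -- For `n` below `K` some of these cells fall outside the block. The letters are read from the
      -- picture, so they are defined all the same.
      frame : ℤ → ℤ → Fin (4 ℕ.* (K ℕ.* n)) → A
      frame x y m =
        let side , r = remQuot {4} (K ℕ.* n) m
            k , t = remQuot {K} n r
        in letter x y (side-cell side k t)

      frame-combine : ∀ x y side k t →
        frame x y (combine side (combine k t)) ≡ letter x y (side-cell side k t)
      frame-combine x y side k t = begin
        frame x y (combine side (combine k t))
          ≡⟨ cong (λ (side , r) → let k , t = remQuot {K} n r in letter x y (side-cell side k t))
                  (remQuot-combine side (combine k t)) ⟩
        (let k′ , t′ = remQuot {K} n (combine k t) in letter x y (side-cell side k′ t′))
          ≡⟨ cong (λ (k , t) → letter x y (side-cell side k t)) (remQuot-combine k t) ⟩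
        letter x y (side-cell side k t) ∎
        where open ≡-Reasoning

      frame-code : (u : Block A n n) → Occurs p u → Fin (s ^ (4 ℕ.* (K ℕ.* n)))
      frame-code _ (x , y , _) = encode (frame x y)

    -- The code may depend on the occurrence chosen for a block. Equal codes still mean equal
    -- letters along the sides of both occurrences, and `picture-determined` applies to the
    -- translation between them.
    frame-code-injective : ∀ (u v : Block A n n) (o : Occurs p u) (o′ : Occurs p v) →
      frame-code u o ≡ frame-code v o′ → u ≡ v
    frame-code-injective u v (x₀ , y₀ , occurs) (x₁ , y₁ , occurs′) same = cell-extensional λ i j →
      begin
      cell u i j
        ≡⟨ occurs i j ⟨
      p (x₀ + + toℕ i) (y₀ + + toℕ j)
        ≡⟨ picture-determined q p sized cover k borderless 3w≤K 3h≤K agree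
             (offset⇒∈ x₀ i) (offset⇒∈ y₀ j) ⟩
      p (x₀ + + toℕ i + (x₁ - x₀)) (y₀ + + toℕ j + (y₁ - y₀))
        ≡⟨ cong₂ p (translate x₀ x₁ (+ toℕ i)) (translate y₀ y₁ (+ toℕ j)) ⟩
      p (x₁ + + toℕ i) (y₁ + + toℕ j)
        ≡⟨ occurs′ i j ⟩
      cell v i j ∎
      where
      open ≡-Reasoning

      translate : ∀ x x′ i → x + i + (x′ - x) ≡ x′ + i
      translate x x′ i = solve (x ∷ x′ ∷ i ∷ [])

      same-letter : ∀ side k t →
        letter x₀ y₀ (side-cell side k t) ≡ letter x₁ y₁ (side-cell side k t)
      same-letter side k t = begin
        letter x₀ y₀ (side-cell side k t)
          ≡⟨ frame-combine x₀ y₀ side k t ⟨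
        frame x₀ y₀ (combine side (combine k t))
          ≡⟨ encode-injective (frame x₀ y₀) (frame x₁ y₁) same (combine side (combine k t)) ⟩
        frame x₁ y₁ (combine side (combine k t))
          ≡⟨ frame-combine x₁ y₁ side k t ⟩
        letter x₁ y₁ (side-cell side k t) ∎

      from-start : ∀ x (i : Fin n) → x + + toℕ i ≺ x + + K →
        Σ[ k ∈ Fin K ] toℕ i ≡ toℕ k
      from-start x i i<K = fromℕ< i<K′ , sym (toℕ-fromℕ< i<K′)
        where
        cancel-≺ : ∀ k {K} → x + k ≺ x + K → k ≺ K
        cancel-≺ k {K} k<K = by k<K (solve (x ∷ k ∷ K ∷ []))
        i<K′ : toℕ i ℕ.< K
        i<K′ = drop‿+≤+ (cancel-≺ (+ toℕ i) i<K)

      from-end : ∀ x (i : Fin n) → x + + n ≤ᶻ x + + toℕ i + + K →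
        Σ[ k ∈ Fin K ] toℕ i ≡ n ∸ suc (toℕ k)
      -- The witness is `n - 1 - i`, the number of cells after `i`.
      from-end x i n≤i+K = fromℕ< k<K , (begin
        toℕ i                           ≡⟨ ℕₚ.m∸[m∸n]≡n (ℕₚ.<⇒≤ (toℕ<n i)) ⟨
        n ∸ (n ∸ toℕ i)                 ≡⟨ cong (n ∸_) (n∸i≡ (toℕ<n i)) ⟩
        n ∸ suc (n ∸ suc (toℕ i))       ≡⟨ cong (λ k → n ∸ suc k) (toℕ-fromℕ< k<K) ⟨
        n ∸ suc (toℕ (fromℕ< k<K))      ∎)
        where
        n∸i≡ : ∀ {i n} → i ℕ.< n → n ∸ i ≡ suc (n ∸ suc i)
        n∸i≡ {i} {suc n} (ℕ.s≤s i≤n) = ℕₚ.+-∸-assoc 1 i≤n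
        cancel-≤ : ∀ n k K → x + n ≤ᶻ x + k + K → n ≤ᶻ k + K
        cancel-≤ n k K n≤k+K = by n≤k+K (solve (x ∷ n ∷ k ∷ K ∷ []))
        n≤i+K′ : n ℕ.≤ toℕ i ℕ.+ K
        n≤i+K′ = drop‿+≤+ (cancel-≤ (+ n) (+ toℕ i) (+ K) n≤i+K)
        k<K : n ∸ suc (toℕ i) ℕ.< K
        k<K = ℕₚ.≤-trans (ℕₚ.≤-reflexive (sym (n∸i≡ (toℕ<n i)))) (ℕₚ.m≤n+o⇒m∸n≤o n (toℕ i) n≤i+K′)

      agree : ∀ {x y} → x ∈[ x₀ ,+ + n ] → y ∈[ y₀ ,+ + n ] →
        NearSides (+ K) x₀ (+ n) x ⊎ NearSides (+ K) y₀ (+ n) y →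
        p x y ≡ p (x + (x₁ - x₀)) (y + (y₁ - y₀))
      agree {x} {y} x∈ y∈ = at-offset (∈⇒offset x∈) (∈⇒offset y∈)
        where
        at-offset : Σ[ i ∈ Fin n ] x ≡ x₀ + + toℕ i → Σ[ j ∈ Fin n ] y ≡ y₀ + + toℕ j →
          NearSides (+ K) x₀ (+ n) x ⊎ NearSides (+ K) y₀ (+ n) y →
          p x y ≡ p (x + (x₁ - x₀)) (y + (y₁ - y₀))
        at-offset (i , refl) (j , refl) near =
          trans (near-letter near)
            (sym (cong₂ p (translate x₀ x₁ (+ toℕ i)) (translate y₀ y₁ (+ toℕ j))))
          where
          near-letter : NearSides (+ K) x₀ (+ n) (x₀ + + toℕ i) ⊎
                        NearSides (+ K) y₀ (+ n) (y₀ + + toℕ j) →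
            letter x₀ y₀ (toℕ i , toℕ j) ≡ letter x₁ y₁ (toℕ i , toℕ j)
          near-letter (inj₁ (inj₁ l)) with from-start x₀ i l
          ... | k , e rewrite e = same-letter 0F k j
          near-letter (inj₁ (inj₂ r)) with from-end x₀ i r
          ... | k , e rewrite e = same-letter 1F k j
          near-letter (inj₂ (inj₁ b)) with from-start y₀ j b
          ... | k , e rewrite e = same-letter 2F k i
          near-letter (inj₂ (inj₂ t)) with from-end y₀ j t
          ... | k , e rewrite e = same-letter 3F k i

    complexity-bound : AtMost (complexity p n n) (s ^ (4 ℕ.* (K ℕ.* n)))
    complexity-bound l (f , f-injective , occurs) =
      injective⇒≤ {f = λ i → frame-code (f i) (occurs i)}
        (λ {i} {j} e → f-injective (frame-code-injective (f i) (f j) (occurs i) (occurs j) e))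

-- The entropy limit

log-below : ∀ {b} C r {m} → 2 ≤ b → AtLeast C 1 → ↥ r ≡ ℤ.- + m → 1 ≤ m → Below (log b C) r
-- The witness `1` suffices, as its logarithm `0` exceeds the negative `r`.
log-below {b} C r {m@(suc _)} 2≤b at-least e 1≤m rewrite e = 1 , at-least , (begin-strict
  1                            <⟨ ℕₚ.^-monoʳ-< b 2≤b 1≤m ⟩
  b ^ m                        ≡⟨ ℕₚ.*-identityˡ (b ^ m) ⟨
  1 ℕ.* b ^ m                  ≡⟨ cong (ℕ._* b ^ m) (ℕₚ.^-zeroˡ (↧ₙ r)) ⟨
  1 ^ (↧ₙ r) ℕ.* b ^ m         ∎)
  where open ℕₚ.≤-Reasoning

-- The last hypothesis is `M < r` with the denominator cleared, where `M` is the logarithm of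
-- `b ^ M`.
log-above : ∀ {b} C r {m} M → 2 ≤ b → AtMost C (b ^ M) → ↥ r ≡ + m →
  M ℕ.* ↧ₙ r ℕ.< m → Above (log b C) r
log-above {b} C r {m} M 2≤b at-most e M*r<m rewrite e = b ^ M , at-most , (begin-strict
  (b ^ M) ^ (↧ₙ r) ℕ.* b ^ ((+ m) ⁻)   ≡⟨ cong (λ k → (b ^ M) ^ (↧ₙ r) ℕ.* b ^ k) (+m⁻≡0 m) ⟩
  (b ^ M) ^ (↧ₙ r) ℕ.* 1               ≡⟨ ℕₚ.*-identityʳ _ ⟩
  (b ^ M) ^ (↧ₙ r)                     ≡⟨ ℕₚ.^-*-assoc b M (↧ₙ r) ⟩
  b ^ (M ℕ.* ↧ₙ r)                     <⟨ ℕₚ.^-monoʳ-< b 2≤b M*r<m ⟩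
  b ^ m                                ≡⟨ cong (b ^_) (ℕₚ.⊔-identityʳ m) ⟨
  b ^ ((+ m) ⁺)                        ∎)
  where
  open ℕₚ.≤-Reasoning
  +m⁻≡0 : ∀ m → (+ m) ⁻ ≡ 0
  +m⁻≡0 zero    = refl
  +m⁻≡0 (suc m) = refl

zero-entropy : ∀ {A : Set} {b} → 2 ≤ b → (p : InfinitePicture A) → ∀ K →
  (∀ n → AtMost (complexity p n n) (b ^ (4 ℕ.* (K ℕ.* n)))) → HasEntropy b p 0ℚᵘ
zero-entropy {b = b} 2≤b p K bound (mkℚᵘ -[1+ _ ] d) (*<* ())
zero-entropy {b = b} 2≤b p K bound (mkℚᵘ (+ 0) d) (*<* (ℤ.+<+ ()))
-- Here `ε` is `(a + 1) / (d + 1)`; the bound `4Kn` on the logarithm drops below `ε` times the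
-- square of `n` once `n` exceeds `4K(d + 1)`.
zero-entropy {b = b} 2≤b p K bound ε@(mkℚᵘ +[1+ a ] d) _ = suc (4 ℕ.* (K ℕ.* suc d)) , λ n N≤n →
  log-below (complexity p n n) ((0ℚᵘ ℚ.- ε) ℚ.* (+ (n ℕ.* n) ℚ./ 1)) 2≤b (some-block n)
    (numerator-below (n ℕ.* n))
    (positive (ℕₚ.≤-trans (ℕ.s≤s ℕ.z≤n) N≤n)) ,
  log-above (complexity p n n) ((0ℚᵘ ℚ.+ ε) ℚ.* (+ (n ℕ.* n) ℚ./ 1)) (4 ℕ.* (K ℕ.* n)) 2≤b
    (bound n) (numerator-above (n ℕ.* n)) (small n N≤n)
  where
  some-block : ∀ n → AtLeast (complexity p n n) 1
  some-block n = (λ _ → window p 0ℤ 0ℤ n n) , (λ { {0F} {0F} _ → refl }) ,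
    λ _ → 0ℤ , 0ℤ , λ i j → sym (cell-window p 0ℤ 0ℤ i j)

  positive : ∀ {n} → 1 ≤ n → 1 ≤ suc a ℕ.* (n ℕ.* n)
  positive (ℕ.s≤s _) = ℕ.s≤s ℕ.z≤n

  numerator : ∀ y m → (0ℤ ℤ.+ y ℤ.* + 1) ℤ.* + m ≡ y ℤ.* + m
  numerator y m = cong (ℤ._* + m) (trans (ℤₚ.+-identityˡ (y ℤ.* + 1)) (ℤₚ.*-identityʳ y))

  numerator-above : ∀ m → ↥ ((0ℚᵘ ℚ.+ ε) ℚ.* (+ m ℚ./ 1)) ≡ + (suc a ℕ.* m)
  numerator-above m = trans (numerator +[1+ a ] m) (sym (ℤₚ.pos-* (suc a) m))

  numerator-below : ∀ m → ↥ ((0ℚᵘ ℚ.- ε) ℚ.* (+ m ℚ./ 1)) ≡ ℤ.- + (suc a ℕ.* m)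
  numerator-below m = trans (numerator -[1+ a ] m)
    (trans (sym (ℤₚ.neg-distribˡ-* +[1+ a ] (+ m))) (cong ℤ.-_ (sym (ℤₚ.pos-* (suc a) m))))

  small : ∀ n → suc (4 ℕ.* (K ℕ.* suc d)) ≤ n →
    4 ℕ.* (K ℕ.* n) ℕ.* ↧ₙ ((0ℚᵘ ℚ.+ ε) ℚ.* (+ (n ℕ.* n) ℚ./ 1)) ℕ.< suc a ℕ.* (n ℕ.* n)
  small n@(suc _) N≤n = begin-strict
    4 ℕ.* (K ℕ.* n) ℕ.* suc ((d ℕ.+ 0) ℕ.* 1)  ≡⟨ rearrange K n d ⟩
    4 ℕ.* (K ℕ.* suc d) ℕ.* n                  <⟨ ℕₚ.*-monoˡ-< n N≤n ⟩
    n ℕ.* n                                    ≤⟨ ℕₚ.m≤m+n (n ℕ.* n) (a ℕ.* (n ℕ.* n)) ⟩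
    suc a ℕ.* (n ℕ.* n)                        ∎
    where
    open ℕₚ.≤-Reasoning
    rearrange : ∀ K n d → 4 ℕ.* (K ℕ.* n) ℕ.* suc ((d ℕ.+ 0) ℕ.* 1) ≡ 4 ℕ.* (K ℕ.* suc d) ℕ.* n
    rearrange K n d = ℕ-Solver.solve (K ∷ n ∷ d ∷ [])

theorem2 : {A : Set} {s : ℕ} → A ↔ Fin s → 2 ≤ s →
    (w h : ℕ) → 1 ≤ w → 1 ≤ h → (q : Block A w h) →
    (p : InfinitePicture A) → Coverable q p →
    (∃[ k ] WithoutNonEmptyBorder q k) →
    HasEntropy s p 0ℚᵘ
theorem2 A↔s 2≤s w h 1≤w 1≤h q p cover (k , borderless) =
  zero-entropy 2≤s p K (complexity-bound (↔⇒↣ A↔s) q p (+≤+ 1≤w , +≤+ 1≤h) cover k borderless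
    (ℕₚ.m≤m+n (w ℕ.+ w ℕ.+ w) (h ℕ.+ h ℕ.+ h)) (ℕₚ.m≤n+m (h ℕ.+ h ℕ.+ h) (w ℕ.+ w ℕ.+ w)))
  where
  K : ℕ
  K = w ℕ.+ w ℕ.+ w ℕ.+ (h ℕ.+ h ℕ.+ h)
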